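{- There exists a simple $4$-$(15,5,2)$ design.
   Context: A $t$-$(v,k,\lambda)$ design consists of a $v$-element set $P$ of points together with a collection $B$ of $k$-element subsets of $P$ (called blocks) such that every $t$-element subset of $P$ is contained in exactly $\lambda$ blocks. The design is simple if $B$ is a set, i.e. contains no repeated blocks. -}

module Defs where

open import Data.Nat using (ℕ)
open import Data.Fin.Subset using (Subset; ∣_∣; _⊆_)
open import Data.Fin.Subset.Properties using (_⊆?_)
open import Data.List using (List; length; filter)
open import Data.List.Relation.Unary.All using (All)
open import Data.List.Relation.Unary.Unique.Propositional using (Unique)
open import Data.Product using (_×_)
open import Relation.Binary.PropositionalEquality using (_≡_)

-- Point set P = Fin v; a block is a subset of Fin v.
-- The block collection is a list of subsets (a multiset); simplicity = no repeats.

countContaining : ∀ {v} → Subset v → List (Subset v) → ℕ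
countContaining T B = length (filter (T ⊆?_) B)

IsDesign : (t v k λ' : ℕ) → List (Subset v) → Set
IsDesign t v k λ' B =
  All (λ b → ∣ b ∣ ≡ k) B ×
  (∀ (T : Subset v) → ∣ T ∣ ≡ t → countContaining T B ≡ λ')

IsSimpleDesign : (t v k λ' : ℕ) → List (Subset v) → Set
IsSimpleDesign t v k λ' B = IsDesign t v k λ' B × Unique B

{-# OPTIONS --safe #-}

-- The design is invariant under the cyclic group of order 13 acting on the points
-- 0, …, 12 by translation and fixing 13 and 14.  Its 546 blocks are the translates of
-- 42 base blocks, found by solving the Kramer–Mesner system of that group.

module Submission where

open import Defs
open import Data.Fin.Subset using (Subset)
open import Data.List using (List)
open import Data.Product using (∃)

open import Data.Bool using (Bool; true; false; if_then_else_; _∧_; T)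
open import Data.Bool.ListAction using (any)
open import Data.Bool.Properties using (T-∧) renaming (_≟_ to _≟ᵇ_)
open import Data.Fin using (toℕ)
open import Data.Fin.Subset using (inside; outside; ∣_∣; _⊆_)
open import Data.Fin.Subset.Properties using (_⊆?_; out⊆)
open import Data.List using ([]; _∷_; concatMap; length; map; upTo)
open import Data.List.Properties using (filter-all)
open import Data.List.Relation.Unary.All using (All; all?; universal)
open import Data.List.Relation.Unary.Unique.Propositional using (Unique)
open import Data.List.Relation.Unary.Unique.DecPropositional using (unique?)
open import Data.Nat using (ℕ; zero; suc; _+_; _%_; _≡ᵇ_; _<ᵇ_; _≟_)
open import Data.Nat.Properties using (≡ᵇ⇒≡; suc-injective)
open import Data.Product using (_,_; proj₁; proj₂)
open import Data.Vec using (tabulate; tail; _∷_; [])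
open import Data.Vec.Properties using (≡-dec)
open import Function using (_∘_; Equivalence)
open import Relation.Binary.PropositionalEquality using (_≡_; refl; cong; trans)
open import Relation.Nullary using (does)
open import Relation.Nullary.Decidable using (from-yes)

private
  variable
    v : ℕ

-- The derived structure at the first point, in the sense of design theory, with repetitions kept.
-- Its counterpart `map tail` deletes that point but keeps every block.
link : List (Subset (suc v)) → List (Subset v)
link []                  = []
link ((inside  ∷ b) ∷ B) = b ∷ link B
link ((outside ∷ b) ∷ B) = link B

countContaining-outside : (S : Subset v) (B : List (Subset (suc v))) →
                          countContaining (outside ∷ S) B ≡ countContaining S (map tail B)
countContaining-outside S []            = refl
-- An `outside` head imposes no condition, so the inclusion test on the longer vectors computes to
-- the boolean of `S ⊆? b`; abstracting it unblocks both filters.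
countContaining-outside S ((_ ∷ b) ∷ B) with does (S ⊆? b)
... | true  = cong suc (countContaining-outside S B)
... | false = countContaining-outside S B

countContaining-inside : (S : Subset v) (B : List (Subset (suc v))) →
                         countContaining (inside ∷ S) B ≡ countContaining S (link B)
countContaining-inside S []                  = refl
countContaining-inside S ((outside ∷ b) ∷ B) = countContaining-inside S B
countContaining-inside S ((inside  ∷ b) ∷ B) with does (S ⊆? b)
... | true  = cong suc (countContaining-inside S B)
... | false = countContaining-inside S B

∣p∣≡0⇒p⊆q : (p q : Subset v) → ∣ p ∣ ≡ 0 → p ⊆ q
∣p∣≡0⇒p⊆q []            []      _     ()
∣p∣≡0⇒p⊆q (outside ∷ p) (_ ∷ q) ∣p∣≡0 = out⊆ (∣p∣≡0⇒p⊆q p q ∣p∣≡0)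

-- Base of the recursion on points: once all chosen points are used up, the rest of the subset is
-- empty and lies in every surviving block.
countContaining-empty : (S : Subset v) (B : List (Subset v)) → ∣ S ∣ ≡ 0 →
                        countContaining S B ≡ length B
countContaining-empty S B ∣S∣≡0 =
  cong length (filter-all (S ⊆?_) (universal {P = S ⊆_} (λ b → ∣p∣≡0⇒p⊆q S b ∣S∣≡0) B))

-- Discarding blocks as soon as they miss a chosen point keeps the search cheap: testing
-- each t-subset against the whole of B would be far slower.
balancedᵇ : (t v λ' : ℕ) → List (Subset v) → Bool
balancedᵇ zero    v       λ' B = length B ≡ᵇ λ'
balancedᵇ (suc t) zero    λ' B = true
balancedᵇ (suc t) (suc v) λ' B =
  balancedᵇ (suc t) v λ' (map tail B) ∧ balancedᵇ t v λ' (link B)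

-- Induction along `balancedᵇ`: the head of `S` selects the conjunct. With no points left and
-- `suc t` still to choose, the cardinality equation is absurd, so the answer `true` there is
-- harmless.
balancedᵇ-sound : ∀ t λ' (B : List (Subset v)) → T (balancedᵇ t v λ' B) →
                  ∀ S → ∣ S ∣ ≡ t → countContaining S B ≡ λ'
balancedᵇ-sound zero    λ' B ok S ∣S∣≡0 =
  trans (countContaining-empty S B ∣S∣≡0) (≡ᵇ⇒≡ (length B) λ' ok)
balancedᵇ-sound (suc t) λ' B ok (outside ∷ S) ∣S∣≡1+t =
  trans (countContaining-outside S B)
        (balancedᵇ-sound (suc t) λ' (map tail B) (proj₁ (Equivalence.to T-∧ ok)) S ∣S∣≡1+t)
balancedᵇ-sound (suc t) λ' B ok (inside ∷ S) ∣S∣≡1+t =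
  trans (countContaining-inside S B)
        (balancedᵇ-sound t λ' (link B) (proj₂ (Equivalence.to T-∧ ok)) S (suc-injective ∣S∣≡1+t))

-- One block per orbit. A 5-subset meets 0, ..., 12 in 3 to 5 points and 13 is prime, so each orbit
-- has 13 blocks; the total 42 · 13 = 546 is the forced value 2 · C(15,4) / C(5,4).
baseBlocks : List (List ℕ)
baseBlocks =
  (0 ∷ 1 ∷ 2 ∷ 3 ∷ 6 ∷ []) ∷ (0 ∷ 1 ∷ 2 ∷ 3 ∷ 11 ∷ []) ∷ (0 ∷ 1 ∷ 2 ∷ 4 ∷ 7 ∷ []) ∷
  (0 ∷ 1 ∷ 2 ∷ 4 ∷ 9 ∷ []) ∷ (0 ∷ 1 ∷ 2 ∷ 5 ∷ 14 ∷ []) ∷ (0 ∷ 1 ∷ 2 ∷ 6 ∷ 13 ∷ []) ∷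
  (0 ∷ 1 ∷ 2 ∷ 7 ∷ 8 ∷ []) ∷ (0 ∷ 1 ∷ 2 ∷ 8 ∷ 14 ∷ []) ∷ (0 ∷ 1 ∷ 2 ∷ 9 ∷ 10 ∷ []) ∷
  (0 ∷ 1 ∷ 2 ∷ 11 ∷ 13 ∷ []) ∷ (0 ∷ 1 ∷ 3 ∷ 4 ∷ 10 ∷ []) ∷ (0 ∷ 1 ∷ 3 ∷ 4 ∷ 14 ∷ []) ∷
  (0 ∷ 1 ∷ 3 ∷ 5 ∷ 11 ∷ []) ∷ (0 ∷ 1 ∷ 3 ∷ 5 ∷ 14 ∷ []) ∷ (0 ∷ 1 ∷ 3 ∷ 7 ∷ 9 ∷ []) ∷
  (0 ∷ 1 ∷ 3 ∷ 7 ∷ 13 ∷ []) ∷ (0 ∷ 1 ∷ 3 ∷ 8 ∷ 13 ∷ []) ∷ (0 ∷ 1 ∷ 3 ∷ 9 ∷ 10 ∷ []) ∷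
  (0 ∷ 1 ∷ 4 ∷ 6 ∷ 13 ∷ []) ∷ (0 ∷ 1 ∷ 4 ∷ 8 ∷ 9 ∷ []) ∷ (0 ∷ 1 ∷ 4 ∷ 8 ∷ 11 ∷ []) ∷
  (0 ∷ 1 ∷ 4 ∷ 10 ∷ 13 ∷ []) ∷ (0 ∷ 1 ∷ 5 ∷ 7 ∷ 10 ∷ []) ∷ (0 ∷ 1 ∷ 5 ∷ 8 ∷ 10 ∷ []) ∷
  (0 ∷ 1 ∷ 5 ∷ 8 ∷ 11 ∷ []) ∷ (0 ∷ 1 ∷ 5 ∷ 9 ∷ 13 ∷ []) ∷ (0 ∷ 1 ∷ 6 ∷ 8 ∷ 10 ∷ []) ∷
  (0 ∷ 1 ∷ 6 ∷ 9 ∷ 11 ∷ []) ∷ (0 ∷ 1 ∷ 6 ∷ 10 ∷ 14 ∷ []) ∷ (0 ∷ 1 ∷ 6 ∷ 11 ∷ 14 ∷ []) ∷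
  (0 ∷ 1 ∷ 7 ∷ 9 ∷ 14 ∷ []) ∷ (0 ∷ 1 ∷ 7 ∷ 11 ∷ 13 ∷ []) ∷ (0 ∷ 1 ∷ 8 ∷ 13 ∷ 14 ∷ []) ∷
  (0 ∷ 1 ∷ 9 ∷ 13 ∷ 14 ∷ []) ∷ (0 ∷ 2 ∷ 4 ∷ 6 ∷ 8 ∷ []) ∷ (0 ∷ 2 ∷ 4 ∷ 13 ∷ 14 ∷ []) ∷
  (0 ∷ 2 ∷ 5 ∷ 7 ∷ 13 ∷ []) ∷ (0 ∷ 2 ∷ 5 ∷ 8 ∷ 13 ∷ []) ∷ (0 ∷ 2 ∷ 5 ∷ 9 ∷ 14 ∷ []) ∷
  (0 ∷ 2 ∷ 6 ∷ 9 ∷ 14 ∷ []) ∷ (0 ∷ 2 ∷ 7 ∷ 10 ∷ 14 ∷ []) ∷ (0 ∷ 3 ∷ 6 ∷ 13 ∷ 14 ∷ []) ∷ []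

translate : ℕ → ℕ → ℕ
translate s x = if x <ᵇ 13 then (x + s) % 13 else x

-- Reduction modulo 13 may unsort a list of points; the characteristic vector forgets the order, so
-- equal blocks become equal vectors.
fromPoints : List ℕ → Subset v
fromPoints xs = tabulate (λ i → any (toℕ i ≡ᵇ_) xs)

blocks : List (Subset 15)
blocks = concatMap (λ s → map (fromPoints ∘ map (translate s)) baseBlocks) (upTo 13)

blocks-balanced : T (balancedᵇ 4 15 2 blocks)
-- The closed boolean evaluates to `true`, so the type is the unit type and its element is inferred.
blocks-balanced = _

blocks-size : All (λ b → ∣ b ∣ ≡ 5) blocks
blocks-size = from-yes (all? (λ b → ∣ b ∣ ≟ 5) blocks)

blocks-unique : Unique blocks
blocks-unique = from-yes (unique? (≡-dec _≟ᵇ_) blocks)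

theorem6 : ∃ λ (B : List (Subset 15)) → IsSimpleDesign 4 15 5 2 B
theorem6 = blocks , (blocks-size , balancedᵇ-sound 4 2 blocks blocks-balanced) , blocks-unique
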